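{- Let $g,f\in\mathcal{F}_0$, and let $(t_{n,k})_{n,k\ge 0}$ be the lower-triangular matrix defined by $$t_{n,k}=[x^{n-k}]\,g(x)f(x)^n .$$ Then $(t_{n,k})$ is the Riordan array $$\left(g\left(\operatorname{Rev}\left(\tfrac{x}{f(x)}\right)\right)\frac{x\left(\operatorname{Rev}\left(\tfrac{x}{f(x)}\right)\right)'}{\operatorname{Rev}\left(\tfrac{x}{f(x)}\right)},\ \operatorname{Rev}\left(\tfrac{x}{f(x)}\right)\right).$$
   Context: All power series are formal power series in $x$ with coefficients in $\mathbb{Q}$. $\mathcal{F}_0$ is the set of series $a_0+a_1x+a_2x^2+\cdots$ with $a_0\neq 0$; $\mathcal{F}_1$ is the set of series $a_1x+a_2x^2+\cdots$ with $a_1\ne 0$. $[x^m]$ extracts the coefficient of $x^m$ (and is $0$ for $m<0$). For $v\in\mathcal{F}_1$, $\operatorname{Rev}(v)\in\mathcal{F}_1$ denotes its compositional inverse. A prime denotes the formal derivative with respect to $x$. For $w\in\mathcal{F}_1$, quotients such as $xw'/w$ are understood as power series after cancelling the factor $x$. For $u\in\mathcal{F}_0$, $v\in\mathcal{F}_1$, the Riordan array $(u,v)=(u(x),v(x))$ is the infinite lower-triangular matrix, indexed by $n,k\ge 0$, with $(n,k)$ entry $[x^n]\,u(x)v(x)^k$. -}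

module Defs where

open import Algebra.Bundles using (CommutativeRing; CommutativeSemiring)
open import Data.Fin.Base using (toℕ)
open import Data.Fin.Properties using (toℕ≤pred[n])
open import Data.Integer.Base as ℤ using (ℤ; +_; -[1+_])
open import Data.Nat.Base as ℕ using (ℕ; zero; suc; _∸_; z≤n; s≤s)
import Data.Nat.Properties as ℕ
open import Data.Product.Base using (_,_)
open import Data.Rational.Base using (ℚ; 0ℚ; 1ℚ; NonZero; ≢-nonZero; 1/_; _÷_)
  renaming (_+_ to _+ℚ_; _*_ to _*ℚ_; _-_ to _-ℚ_; _/_ to _/ℚ_)
import Data.Rational.Properties as ℚ
open import Data.Rational.Solver using (module +-*-Solver)
open import Level using (0ℓ)
open import Relation.Binary.PropositionalEquality
  using (_≡_; _≢_; refl; sym; trans; cong; cong₂; module ≡-Reasoning)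

open import Algebra.Properties.Semiring.Sum (CommutativeRing.semiring ℚ.+-*-commutativeRing)
  using (sum; sum⁺-syntax; sum-syntax; sum-cong-≗; ∑-distrib-+; ∑-comm; *-distribˡ-sum)

infix  4 _≈_ _≈[_]_
infixl 6 _+_
infixl 7 _*_ _/_ _∙_
infix  9 _⟨_⟩

-- A series is its sequence of coefficients; two series are equal when all
-- their coefficients are.
Series : Set
Series = ℕ → ℚ

_≈_ : Series → Series → Set
a ≈ b = ∀ n → a n ≡ b n

[x^_]_ : ℤ → Series → ℚ
[x^ + n ]      a = a n
[x^ -[1+ _ ] ] a = 0ℚ

const : ℚ → Series
const c zero    = c
const c (suc _) = 0ℚ

-- For a series without constant term this is division by x.
tail : Series → Series
tail a n = a (suc n)

X : Series
X zero    = 0ℚ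
X (suc n) = const 1ℚ n

_+_ : Series → Series → Series
(a + b) n = a n +ℚ b n

_∙_ : ℚ → Series → Series
(c ∙ a) n = c *ℚ a n

_*_ : Series → Series → Series
(a * b) n = ∑[ i ≤ n ] (a (toℕ i) *ℚ b (n ∸ toℕ i))

D : Series → Series
D a n = (+ suc n /ℚ 1) *ℚ a (suc n)

module _ where
  open ≡-Reasoning
  open +-*-Solver

  *-cong : ∀ {a a′ b b′} → a ≈ a′ → b ≈ b′ → a * b ≈ a′ * b′
  *-cong p q n = sum-cong-≗ {suc n} λ i → cong₂ _*ℚ_ (p (toℕ i)) (q (n ∸ toℕ i))

  *-snoc : ∀ a b n → (a * b) (suc n) ≡ (a * tail b) n +ℚ a (suc n) *ℚ b 0
  *-snoc a b zero    = solve 4 (λ p q r s → p :* q :+ (r :* s :+ con 0ℚ) := (p :* q :+ con 0ℚ) :+ r :* s) refl (a 0) (b 1) (a 1) (b 0)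
  *-snoc a b (suc n) = trans
    (cong (a 0 *ℚ b (suc (suc n)) +ℚ_) (*-snoc (tail a) b n))
    (sym (ℚ.+-assoc (a 0 *ℚ b (suc (suc n))) ((tail a * tail b) n) _))

  *-comm : ∀ a b → a * b ≈ b * a
  *-comm a b zero    = cong (_+ℚ 0ℚ) (ℚ.*-comm (a 0) (b 0))
  *-comm a b (suc n) = begin
    a 0 *ℚ b (suc n) +ℚ (tail a * b) n ≡⟨ cong₂ _+ℚ_ (ℚ.*-comm (a 0) _) (*-comm (tail a) b n) ⟩
    b (suc n) *ℚ a 0 +ℚ (b * tail a) n ≡⟨ ℚ.+-comm _ ((b * tail a) n) ⟩
    (b * tail a) n +ℚ b (suc n) *ℚ a 0 ≡⟨ *-snoc b a n ⟨
    (b * a) (suc n)                    ∎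

  *-distribʳ-+ : ∀ c a b → (a + b) * c ≈ a * c + b * c
  *-distribʳ-+ c a b n = trans
    (sum-cong-≗ {suc n} λ i → ℚ.*-distribʳ-+ (c (n ∸ toℕ i)) (a (toℕ i)) (b (toℕ i)))
    (∑-distrib-+ {suc n} (λ i → a (toℕ i) *ℚ c (n ∸ toℕ i)) (λ i → b (toℕ i) *ℚ c (n ∸ toℕ i)))

  *-distribˡ-+ : ∀ c a b → c * (a + b) ≈ c * a + c * b
  *-distribˡ-+ c a b n = begin
    (c * (a + b)) n         ≡⟨ *-comm c (a + b) n ⟩
    ((a + b) * c) n         ≡⟨ *-distribʳ-+ c a b n ⟩
    (a * c) n +ℚ (b * c) n  ≡⟨ cong₂ _+ℚ_ (*-comm a c n) (*-comm b c n) ⟩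
    (c * a) n +ℚ (c * b) n  ∎

  ∙-* : ∀ c a b → (c ∙ a) * b ≈ c ∙ (a * b)
  ∙-* c a b n = trans
    (sum-cong-≗ {suc n} λ i → ℚ.*-assoc c (a (toℕ i)) (b (n ∸ toℕ i)))
    (sym (*-distribˡ-sum {suc n} c (λ i → a (toℕ i) *ℚ b (n ∸ toℕ i))))

  *-assoc : ∀ a b c → (a * b) * c ≈ a * (b * c)
  *-assoc a b c zero    =
    solve 3 (λ p q r → (p :* q :+ con 0ℚ) :* r :+ con 0ℚ := p :* (q :* r :+ con 0ℚ) :+ con 0ℚ) refl (a 0) (b 0) (c 0)
  *-assoc a b c (suc n) = begin
    (a * b) 0 *ℚ c (suc n) +ℚ (tail (a * b) * c) n
      ≡⟨ cong ((a * b) 0 *ℚ c (suc n) +ℚ_) (*-distribʳ-+ c (a 0 ∙ tail b) (tail a * b) n) ⟩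
    (a * b) 0 *ℚ c (suc n) +ℚ (((a 0 ∙ tail b) * c) n +ℚ ((tail a * b) * c) n)
      ≡⟨ cong ((a * b) 0 *ℚ c (suc n) +ℚ_) (cong₂ _+ℚ_ (∙-* (a 0) (tail b) c n) (*-assoc (tail a) b c n)) ⟩
    (a * b) 0 *ℚ c (suc n) +ℚ (a 0 *ℚ (tail b * c) n +ℚ (tail a * (b * c)) n)
      ≡⟨ solve 5 (λ p q r s t → (p :* q :+ con 0ℚ) :* r :+ (p :* s :+ t) := p :* (q :* r :+ s) :+ t) refl
           (a 0) (b 0) (c (suc n)) ((tail b * c) n) ((tail a * (b * c)) n) ⟩
    a 0 *ℚ (b * c) (suc n) +ℚ (tail a * (b * c)) n ∎

  *-zeroˡ : ∀ a → const 0ℚ * a ≈ const 0ℚ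
  *-zeroˡ a zero    = trans (ℚ.+-identityʳ (0ℚ *ℚ a 0)) (ℚ.*-zeroˡ (a 0))
  *-zeroˡ a (suc n) = trans (cong₂ _+ℚ_ (ℚ.*-zeroˡ (a (suc n))) (trans (*-cong {b = a} tail-zero (λ _ → refl) n) (*-zeroˡ a n))) (zero-sum n)
    where
    tail-zero : tail (const 0ℚ) ≈ const 0ℚ
    tail-zero zero    = refl
    tail-zero (suc _) = refl
    zero-sum : ∀ n → 0ℚ +ℚ const 0ℚ n ≡ 0ℚ
    zero-sum zero    = refl
    zero-sum (suc _) = refl

  const-* : ∀ c a → const c * a ≈ c ∙ a
  const-* c a zero    = ℚ.+-identityʳ (c *ℚ a 0)
  const-* c a (suc n) = trans (cong (c *ℚ a (suc n) +ℚ_) (trans (*-cong {b = a} tail-const (λ _ → refl) n) (trans (*-zeroˡ a n) (const0 n)))) (ℚ.+-identityʳ _)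
    where
    tail-const : tail (const c) ≈ const 0ℚ
    tail-const zero    = refl
    tail-const (suc _) = refl
    const0 : const 0ℚ ≈ λ _ → 0ℚ
    const0 zero    = refl
    const0 (suc _) = refl

  const-0 : ∀ n → const 0ℚ n ≡ 0ℚ
  const-0 zero    = refl
  const-0 (suc _) = refl

  *-identityˡ : ∀ a → const 1ℚ * a ≈ a
  *-identityˡ a n = trans (const-* 1ℚ a n) (ℚ.*-identityˡ (a n))

commutativeSemiring : CommutativeSemiring 0ℓ 0ℓ
commutativeSemiring = record
  { Carrier = Series ; _≈_ = _≈_ ; _+_ = _+_ ; _*_ = _*_ ; 0# = const 0ℚ ; 1# = const 1ℚ
  ; isCommutativeSemiring = record
    { isSemiring = record
      { isSemiringWithoutAnnihilatingZero = record
        { +-isCommutativeMonoid = record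
          { isMonoid = record
            { isSemigroup = record
              { isMagma = record
                { isEquivalence = record
                  { refl  = λ _ → refl
                  ; sym   = λ p n → sym (p n)
                  ; trans = λ p q n → trans (p n) (q n) }
                ; ∙-cong = λ p q n → cong₂ _+ℚ_ (p n) (q n) }
              ; assoc = λ a b c n → ℚ.+-assoc (a n) (b n) (c n) }
            ; identity = (λ a n → trans (cong (_+ℚ a n) (const-0 n)) (ℚ.+-identityˡ (a n)))
                       , (λ a n → trans (cong (a n +ℚ_) (const-0 n)) (ℚ.+-identityʳ (a n))) }
          ; comm = λ a b n → ℚ.+-comm (a n) (b n) }
        ; *-cong = λ {a} {a′} {b} {b′} → *-cong {a} {a′} {b} {b′}
        ; *-assoc = *-assoc
        ; *-identity = *-identityˡ , λ a n → trans (*-comm a (const 1ℚ) n) (*-identityˡ a n)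
        ; distrib = *-distribˡ-+ , *-distribʳ-+ }
      ; zero = *-zeroˡ , λ a n → trans (*-comm a (const 0ℚ) n) (*-zeroˡ a n) }
    ; *-comm = *-comm } }

open import Algebra.Properties.Semiring.Exp (CommutativeSemiring.semiring commutativeSemiring)
  using (_^_; ^-congˡ)

-- [x^n] a(v(x)), the sum over all k of a_k [x^n] v^k.  It is meaningful only
-- when v 0 ≡ 0ℚ: then the terms with k > n vanish (^-order).
_⟨_⟩ : Series → Series → Series
(a ⟨ v ⟩) n = ∑[ k ≤ n ] (a (toℕ k) *ℚ (v ^ toℕ k) n)

_≈[_]_ : Series → ℕ → Series → Set
a ≈[ n ] b = ∀ i → i ℕ.< n → a i ≡ b i

module _ where
  open ≡-Reasoning

  *-cong[_] : ∀ n {a a′ b b′} → a ≈[ n ] a′ → b ≈[ n ] b′ → a * b ≈[ n ] a′ * b′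
  *-cong[ n ] p q i i<n = sum-cong-≗ {suc i} λ j → cong₂ _*ℚ_
    (p (toℕ j) (ℕ.<-≤-trans (s≤s (toℕ≤pred[n] j)) i<n))
    (q (i ∸ toℕ j) (ℕ.≤-<-trans (ℕ.m∸n≤m i (toℕ j)) i<n))

  ≡0-* : ∀ {p} → p ≡ 0ℚ → ∀ q → p *ℚ q ≡ 0ℚ
  ≡0-* refl = ℚ.*-zeroˡ

  *-guard : ∀ {v a b} n → v 0 ≡ 0ℚ → a ≈[ n ] b → v * a ≈[ suc n ] v * b
  *-guard {v} {a} {b} n v₀ p zero    _         = cong (_+ℚ 0ℚ) (trans (≡0-* v₀ (a 0)) (sym (≡0-* v₀ (b 0))))
  *-guard {v} {a} {b} n v₀ p (suc i) (s≤s i<n) = cong₂ _+ℚ_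
    (trans (≡0-* v₀ (a (suc i))) (sym (≡0-* v₀ (b (suc i)))))
    (*-cong[ n ] {tail v} (λ _ _ → refl) p i i<n)

  *-tail : ∀ v a → v 0 ≡ 0ℚ → ∀ n → (v * a) (suc n) ≡ (tail v * a) n
  *-tail v a v₀ n = trans
    (cong (_+ℚ (tail v * a) n) (≡0-* v₀ (a (suc n))))
    (ℚ.+-identityˡ _)

  ^-order : ∀ v → v 0 ≡ 0ℚ → ∀ k → v ^ k ≈[ k ] const 0ℚ
  ^-order v v₀ (suc k) i i<k = begin
    (v * v ^ k) i     ≡⟨ *-guard {v} k v₀ (^-order v v₀ k) i i<k ⟩
    (v * const 0ℚ) i  ≡⟨ *-comm v (const 0ℚ) i ⟩
    (const 0ℚ * v) i  ≡⟨ *-zeroˡ v i ⟩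
    const 0ℚ i        ∎

  sum-zero : ∀ n {h : ℕ → ℚ} → (∀ k → h k ≡ 0ℚ) → ∑[ k < n ] h (toℕ k) ≡ 0ℚ
  sum-zero zero    p = refl
  sum-zero (suc n) p = trans (cong₂ _+ℚ_ (p 0) (sum-zero n (λ k → p (suc k)))) (ℚ.+-identityˡ 0ℚ)

  sum-extend : ∀ {m n} {h : ℕ → ℚ} → (∀ k → m ℕ.≤ k → h k ≡ 0ℚ) → m ℕ.≤ n →
               ∑[ k < m ] h (toℕ k) ≡ ∑[ k < n ] h (toℕ k)
  sum-extend {n = n} p z≤n       = sym (sum-zero n (λ k → p k z≤n))
  sum-extend {h = h} p (s≤s m≤n) = cong (h 0 +ℚ_) (sum-extend (λ k m≤k → p (suc k) (s≤s m≤k)) m≤n)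

  term-zero : ∀ v → v 0 ≡ 0ℚ → ∀ c {k m} → m ℕ.< k → c *ℚ (v ^ k) m ≡ 0ℚ
  term-zero v v₀ c {k} {m} m<k =
    trans (cong (c *ℚ_) (trans (^-order v v₀ k m m<k) (const-0 m))) (ℚ.*-zeroʳ c)

  ⟨⟩-horner : ∀ a v → v 0 ≡ 0ℚ → a ⟨ v ⟩ ≈ const (a 0) + v * tail a ⟨ v ⟩
  ⟨⟩-horner a v v₀ n = cong₂ _+ℚ_ (const-term n) (begin
    ∑[ k < n ] (a (suc (toℕ k)) *ℚ (v ^ suc (toℕ k)) n)
      ≡⟨ sum-extend {n} {suc n} (λ k n≤k → term-zero v v₀ (a (suc k)) (s≤s n≤k)) (ℕ.n≤1+n n) ⟩
    ∑[ k ≤ n ] (a (suc (toℕ k)) *ℚ ∑[ i ≤ n ] (v (toℕ i) *ℚ (v ^ toℕ k) (n ∸ toℕ i)))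
      ≡⟨ (sum-cong-≗ {suc n} λ k → *-distribˡ-sum {suc n} (a (suc (toℕ k))) (λ i → v (toℕ i) *ℚ (v ^ toℕ k) (n ∸ toℕ i))) ⟩
    ∑[ k ≤ n ] ∑[ i ≤ n ] (a (suc (toℕ k)) *ℚ (v (toℕ i) *ℚ (v ^ toℕ k) (n ∸ toℕ i)))
      ≡⟨ ∑-comm {suc n} {suc n} (λ k i → a (suc (toℕ k)) *ℚ (v (toℕ i) *ℚ (v ^ toℕ k) (n ∸ toℕ i))) ⟩
    ∑[ i ≤ n ] ∑[ k ≤ n ] (a (suc (toℕ k)) *ℚ (v (toℕ i) *ℚ (v ^ toℕ k) (n ∸ toℕ i)))
      ≡⟨ (sum-cong-≗ {suc n} λ i → sum-cong-≗ {suc n} λ k → swap (a (suc (toℕ k))) (v (toℕ i)) ((v ^ toℕ k) (n ∸ toℕ i))) ⟩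
    ∑[ i ≤ n ] ∑[ k ≤ n ] (v (toℕ i) *ℚ (a (suc (toℕ k)) *ℚ (v ^ toℕ k) (n ∸ toℕ i)))
      ≡⟨ (sum-cong-≗ {suc n} λ i → *-distribˡ-sum {suc n} (v (toℕ i)) (λ k → a (suc (toℕ k)) *ℚ (v ^ toℕ k) (n ∸ toℕ i))) ⟨
    ∑[ i ≤ n ] (v (toℕ i) *ℚ ∑[ k ≤ n ] (a (suc (toℕ k)) *ℚ (v ^ toℕ k) (n ∸ toℕ i)))
      ≡⟨ (sum-cong-≗ {suc n} λ i → cong (v (toℕ i) *ℚ_)
           (sum-extend {suc (n ∸ toℕ i)} {suc n} (λ k → term-zero v v₀ (a (suc k))) (s≤s (ℕ.m∸n≤m n (toℕ i))))) ⟨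
    (v * tail a ⟨ v ⟩) n ∎)
    where
    const-term : ∀ n → a 0 *ℚ const 1ℚ n ≡ const (a 0) n
    const-term zero    = ℚ.*-identityʳ (a 0)
    const-term (suc _) = ℚ.*-zeroʳ (a 0)
    swap : ∀ p q r → p *ℚ (q *ℚ r) ≡ q *ℚ (p *ℚ r)
    swap = let open +-*-Solver in solve 3 (λ p q r → p :* (q :* r) := q :* (p :* r)) refl

  ⟨⟩-head : ∀ a v → (a ⟨ v ⟩) 0 ≡ a 0
  ⟨⟩-head a v = trans (ℚ.+-identityʳ _) (ℚ.*-identityʳ (a 0))

  ⟨⟩-cong : ∀ {a b v w} → a ≈ b → v ≈ w → a ⟨ v ⟩ ≈ b ⟨ w ⟩
  ⟨⟩-cong {v = v} {w} p q n = sum-cong-≗ {suc n} λ k →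
    cong₂ _*ℚ_ (p (toℕ k)) (^-congˡ (toℕ k) {v} {w} q n)

  ⟨⟩-+ : ∀ a b v → (a + b) ⟨ v ⟩ ≈ a ⟨ v ⟩ + b ⟨ v ⟩
  ⟨⟩-+ a b v n = trans
    (sum-cong-≗ {suc n} λ k → ℚ.*-distribʳ-+ ((v ^ toℕ k) n) (a (toℕ k)) (b (toℕ k)))
    (∑-distrib-+ {suc n} (λ k → a (toℕ k) *ℚ (v ^ toℕ k) n) (λ k → b (toℕ k) *ℚ (v ^ toℕ k) n))

  ⟨⟩-∙ : ∀ c a v → (c ∙ a) ⟨ v ⟩ ≈ c ∙ a ⟨ v ⟩
  ⟨⟩-∙ c a v n = trans
    (sum-cong-≗ {suc n} λ k → ℚ.*-assoc c (a (toℕ k)) ((v ^ toℕ k) n))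
    (sym (*-distribˡ-sum {suc n} c (λ k → a (toℕ k) *ℚ (v ^ toℕ k) n)))

  ⟨⟩-const : ∀ c v → const c ⟨ v ⟩ ≈ const c
  ⟨⟩-const c v zero    = ⟨⟩-head (const c) v
  ⟨⟩-const c v (suc n) = trans (cong₂ _+ℚ_ (ℚ.*-zeroʳ c)
    (sum-zero (suc n) (λ k → ℚ.*-zeroˡ ((v ^ suc k) (suc n))))) (ℚ.+-identityˡ 0ℚ)

module _ where
  open CommutativeSemiring commutativeSemiring
    using (setoid; +-cong; +-congˡ; +-congʳ; *-congˡ; *-congʳ) 
  open import Relation.Binary.Reasoning.Setoid setoid
  open import Algebra.Solver.Ring.NaturalCoefficients.Default commutativeSemiring
    using (solve; _:+_; _:*_; _:=_)

  ∀[]⇒≈ : ∀ {a b} → (∀ n → a ≈[ n ] b) → a ≈ b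
  ∀[]⇒≈ p n = p (suc n) n (ℕ.n<1+n n)

  ⟨⟩-*[_] : ∀ n a b v → v 0 ≡ 0ℚ → (a * b) ⟨ v ⟩ ≈[ n ] a ⟨ v ⟩ * b ⟨ v ⟩
  ⟨⟩-*[ suc n ] a b v v₀ i i<n = trans (lhs i)
    (trans (cong (const ((a * b) 0) i +ℚ_) (*-guard {v} n v₀ step i i<n)) (rhs i))
    where
    A = tail a ⟨ v ⟩
    B = b ⟨ v ⟩
    B′ = tail b ⟨ v ⟩
    lhs : (a * b) ⟨ v ⟩ ≈ const ((a * b) 0) + v * tail (a * b) ⟨ v ⟩
    lhs = ⟨⟩-horner (a * b) v v₀
    step : tail (a * b) ⟨ v ⟩ ≈[ n ] const (a 0) * B′ + A * B
    step j j<n = trans (⟨⟩-+ (a 0 ∙ tail b) (tail a * b) v j)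
      (cong₂ _+ℚ_ (trans (⟨⟩-∙ (a 0) (tail b) v j) (sym (const-* (a 0) B′ j))) (⟨⟩-*[ n ] (tail a) b v v₀ j j<n))
    const-head : const ((a * b) 0) ≈ const (a 0) * const (b 0)
    const-head zero    = refl
    const-head (suc k) = sym (trans (const-* (a 0) (const (b 0)) (suc k)) (ℚ.*-zeroʳ (a 0)))
    rhs : const ((a * b) 0) + v * (const (a 0) * B′ + A * B) ≈ a ⟨ v ⟩ * b ⟨ v ⟩
    rhs = begin
      const ((a * b) 0) + v * (const (a 0) * B′ + A * B)
        ≈⟨ +-congʳ {v * (const (a 0) * B′ + A * B)} {const ((a * b) 0)} const-head ⟩
      const (a 0) * const (b 0) + v * (const (a 0) * B′ + A * B)
        ≈⟨ solve 6 (λ a₀ b₀ V P Q R → a₀ :* b₀ :+ V :* (a₀ :* P :+ Q :* R) := a₀ :* (b₀ :+ V :* P) :+ (V :* Q) :* R)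
             (λ _ → refl) (const (a 0)) (const (b 0)) v B′ A B ⟩
      const (a 0) * (const (b 0) + v * B′) + v * A * B
        ≈⟨ +-congʳ {v * A * B} (*-congˡ {const (a 0)} {B} (⟨⟩-horner b v v₀)) ⟨
      const (a 0) * B + v * A * B
        ≈⟨ *-distribʳ-+ B (const (a 0)) (v * A) ⟨
      (const (a 0) + v * A) * B
        ≈⟨ *-congʳ {B} {a ⟨ v ⟩} (⟨⟩-horner a v v₀) ⟨
      a ⟨ v ⟩ * b ⟨ v ⟩ ∎

  ⟨⟩-* : ∀ a b v → v 0 ≡ 0ℚ → (a * b) ⟨ v ⟩ ≈ a ⟨ v ⟩ * b ⟨ v ⟩
  ⟨⟩-* a b v v₀ = ∀[]⇒≈ (λ n → ⟨⟩-*[ n ] a b v v₀)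

  ⟨⟩-assoc[_] : ∀ n a u v → u 0 ≡ 0ℚ → v 0 ≡ 0ℚ → (a ⟨ u ⟩) ⟨ v ⟩ ≈[ n ] a ⟨ u ⟨ v ⟩ ⟩
  ⟨⟩-assoc[ suc n ] a u v u₀ v₀ i i<n = trans (lhs i)
    (trans (cong (const (a 0) i +ℚ_) (*-guard {u ⟨ v ⟩} n uv₀ (⟨⟩-assoc[ n ] (tail a) u v u₀ v₀) i i<n))
           (sym (⟨⟩-horner a (u ⟨ v ⟩) uv₀ i)))
    where
    uv₀ : (u ⟨ v ⟩) 0 ≡ 0ℚ
    uv₀ = trans (⟨⟩-head u v) u₀
    A = tail a ⟨ u ⟩
    lhs : (a ⟨ u ⟩) ⟨ v ⟩ ≈ const (a 0) + u ⟨ v ⟩ * A ⟨ v ⟩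
    lhs = begin
      (a ⟨ u ⟩) ⟨ v ⟩                       ≈⟨ ⟨⟩-cong {v = v} (⟨⟩-horner a u u₀) (λ _ → refl) ⟩
      (const (a 0) + u * A) ⟨ v ⟩           ≈⟨ ⟨⟩-+ (const (a 0)) (u * A) v ⟩
      const (a 0) ⟨ v ⟩ + (u * A) ⟨ v ⟩     ≈⟨ +-cong (⟨⟩-const (a 0) v) (⟨⟩-* u A v v₀) ⟩
      const (a 0) + u ⟨ v ⟩ * A ⟨ v ⟩       ∎

  ⟨⟩-assoc : ∀ a u v → u 0 ≡ 0ℚ → v 0 ≡ 0ℚ → (a ⟨ u ⟩) ⟨ v ⟩ ≈ a ⟨ u ⟨ v ⟩ ⟩
  ⟨⟩-assoc a u v u₀ v₀ = ∀[]⇒≈ (λ n → ⟨⟩-assoc[ n ] a u v u₀ v₀)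

  X-* : ∀ a n → (X * a) (suc n) ≡ a n
  X-* a n = trans (*-tail X a refl n) (*-identityˡ a n)

  ⟨⟩-X[_] : ∀ n a → a ⟨ X ⟩ ≈[ n ] a
  ⟨⟩-X[ suc n ] a zero    _         = ⟨⟩-head a X
  ⟨⟩-X[ suc n ] a (suc i) (s≤s i<n) =
    trans (⟨⟩-horner a X refl (suc i)) (trans (ℚ.+-identityˡ ((X * tail a ⟨ X ⟩) (suc i)))
      (trans (X-* (tail a ⟨ X ⟩) i) (⟨⟩-X[ n ] (tail a) i i<n)))

  ⟨⟩-X : ∀ a → a ⟨ X ⟩ ≈ a
  ⟨⟩-X a = ∀[]⇒≈ (λ n → ⟨⟩-X[ n ] a)

  X-⟨⟩ : ∀ v → v 0 ≡ 0ℚ → X ⟨ v ⟩ ≈ v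
  X-⟨⟩ v v₀ = begin
    X ⟨ v ⟩                              ≈⟨ ⟨⟩-horner X v v₀ ⟩
    const 0ℚ + v * const 1ℚ ⟨ v ⟩        ≈⟨ CommutativeSemiring.+-identityˡ commutativeSemiring _ ⟩
    v * const 1ℚ ⟨ v ⟩                   ≈⟨ *-congˡ {v} {const 1ℚ ⟨ v ⟩} (⟨⟩-const 1ℚ v) ⟩
    v * const 1ℚ                         ≈⟨ CommutativeSemiring.*-identityʳ commutativeSemiring v ⟩
    v                                    ∎

record 𝓕₀ : Set where
  constructor mk𝓕₀
  field
    series : Series
    head≢0 : series 0 ≢ 0ℚ

  head-nonZero : NonZero (series 0)
  head-nonZero = ≢-nonZero head≢0

record 𝓕₁ : Set where
  constructor mk𝓕₁
  field
    series  : Series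
    head≡0  : series 0 ≡ 0ℚ
    coeff≢0 : series 1 ≢ 0ℚ

  series/x : 𝓕₀
  series/x = mk𝓕₀ (tail series) coeff≢0

open 𝓕₀ using () renaming (series to ⌊_⌋₀) public
open 𝓕₁ using () renaming (series to ⌊_⌋₁) public

-- Long division; see /-*.
_/_ : Series → 𝓕₀ → Series
(h / f) zero    = (h 0 ÷ ⌊ f ⌋₀ 0) ⦃ 𝓕₀.head-nonZero f ⦄
(h / f) (suc n) = ((λ m → h (suc m) -ℚ (h / f) 0 *ℚ ⌊ f ⌋₀ (suc m)) / f) n

/-head : ∀ h f → (h / f) 0 *ℚ ⌊ f ⌋₀ 0 ≡ h 0
/-head h f = trans (ℚ.*-assoc (h 0) _ _)
  (trans (cong (h 0 *ℚ_) (ℚ.*-inverseˡ (⌊ f ⌋₀ 0) ⦃ 𝓕₀.head-nonZero f ⦄)) (ℚ.*-identityʳ (h 0)))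

/-* : ∀ h f → (h / f) * ⌊ f ⌋₀ ≈ h
/-* h f zero    = trans (ℚ.+-identityʳ _) (/-head h f)
/-* h f (suc n) = trans
  (cong ((h / f) 0 *ℚ ⌊ f ⌋₀ (suc n) +ℚ_) (/-* (λ m → h (suc m) -ℚ (h / f) 0 *ℚ ⌊ f ⌋₀ (suc m)) f n))
  (solve 2 (λ p q → p :+ (q :- p) := q) refl ((h / f) 0 *ℚ ⌊ f ⌋₀ (suc n)) (h (suc n)))
  where open +-*-Solver

-- The series s with s(v) = h (expand-⟨⟩): comparing s(v) = s₀ + v · (tail s)(v)
-- with h gives s₀ = h₀ and (tail s)(v) = (h - h₀) / v.
expand : Series → 𝓕₁ → Series
expand h v zero    = h 0
expand h v (suc n) = expand (tail h / 𝓕₁.series/x v) v n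

expand-⟨⟩[_] : ∀ n h v → expand h v ⟨ ⌊ v ⌋₁ ⟩ ≈[ n ] h
expand-⟨⟩[ suc n ] h v zero    _   = ⟨⟩-head (expand h v) ⌊ v ⌋₁
expand-⟨⟩[ suc n ] h v (suc i) i<n = begin
  (expand h v ⟨ ⌊ v ⌋₁ ⟩) (suc i)            ≡⟨ ⟨⟩-horner (expand h v) ⌊ v ⌋₁ v₀ (suc i) ⟩
  0ℚ +ℚ (⌊ v ⌋₁ * expand q v ⟨ ⌊ v ⌋₁ ⟩) (suc i) ≡⟨ ℚ.+-identityˡ _ ⟩
  (⌊ v ⌋₁ * expand q v ⟨ ⌊ v ⌋₁ ⟩) (suc i)   ≡⟨ *-guard {⌊ v ⌋₁} n v₀ (expand-⟨⟩[ n ] q v) (suc i) i<n ⟩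
  (⌊ v ⌋₁ * q) (suc i)                       ≡⟨ *-tail ⌊ v ⌋₁ q v₀ i ⟩
  (tail ⌊ v ⌋₁ * q) i                        ≡⟨ *-comm (tail ⌊ v ⌋₁) q i ⟩
  (q * tail ⌊ v ⌋₁) i                        ≡⟨ /-* (tail h) (𝓕₁.series/x v) i ⟩
  h (suc i)                                  ∎
  where
  open ≡-Reasoning
  v₀ = 𝓕₁.head≡0 v
  q = tail h / 𝓕₁.series/x v

expand-⟨⟩ : ∀ h v → expand h v ⟨ ⌊ v ⌋₁ ⟩ ≈ h
expand-⟨⟩ h v n = expand-⟨⟩[ suc n ] h v n (ℕ.n<1+n n)

*ℚ-≢0 : ∀ {p q} → p ≢ 0ℚ → q ≢ 0ℚ → p *ℚ q ≢ 0ℚ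
*ℚ-≢0 {p} {q} p≢0 q≢0 pq≡0 = p≢0 (begin
  p                  ≡⟨ ℚ.*-identityʳ p ⟨
  p *ℚ 1ℚ            ≡⟨ cong (p *ℚ_) (ℚ.*-inverseʳ q) ⟨
  p *ℚ (q *ℚ 1/ q)   ≡⟨ ℚ.*-assoc p q (1/ q) ⟨
  p *ℚ q *ℚ 1/ q     ≡⟨ cong (_*ℚ 1/ q) pq≡0 ⟩
  0ℚ *ℚ 1/ q         ≡⟨ ℚ.*-zeroˡ (1/ q) ⟩
  0ℚ                 ∎)
  where
  open ≡-Reasoning
  instance _ = ≢-nonZero q≢0

/-≢0 : ∀ h f → h 0 ≢ 0ℚ → (h / f) 0 ≢ 0ℚ
/-≢0 h f h≢0 q≡0 = h≢0 (trans (sym (/-head h f)) (≡0-* q≡0 (⌊ f ⌋₀ 0)))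

1≢0 : 1ℚ ≢ 0ℚ
1≢0 ()

Rev : 𝓕₁ → 𝓕₁
Rev v = mk𝓕₁ (expand X v) refl (/-≢0 (tail X) (𝓕₁.series/x v) 1≢0)

Rev-⟨⟩ : ∀ v → ⌊ Rev v ⌋₁ ⟨ ⌊ v ⌋₁ ⟩ ≈ X
Rev-⟨⟩ v = expand-⟨⟩ X v

⟨⟩-Rev : ∀ v → ⌊ v ⌋₁ ⟨ ⌊ Rev v ⌋₁ ⟩ ≈ X
⟨⟩-Rev v = begin
  ⌊ v ⌋₁ ⟨ s ⟩             ≈⟨ ⟨⟩-cong {v = s} v≈t (λ _ → refl) ⟩
  t ⟨ s ⟩                  ≈⟨ Rev-⟨⟩ (Rev v) ⟩
  X                        ∎
  where
  open import Relation.Binary.Reasoning.Setoid (CommutativeSemiring.setoid commutativeSemiring)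
  s = ⌊ Rev v ⌋₁
  t = ⌊ Rev (Rev v) ⌋₁
  v≈t : ⌊ v ⌋₁ ≈ t
  v≈t = begin
    ⌊ v ⌋₁                 ≈⟨ X-⟨⟩ ⌊ v ⌋₁ (𝓕₁.head≡0 v) ⟨
    X ⟨ ⌊ v ⌋₁ ⟩           ≈⟨ ⟨⟩-cong {v = ⌊ v ⌋₁} (Rev-⟨⟩ (Rev v)) (λ _ → refl) ⟨
    (t ⟨ s ⟩) ⟨ ⌊ v ⌋₁ ⟩   ≈⟨ ⟨⟩-assoc t s ⌊ v ⌋₁ refl (𝓕₁.head≡0 v) ⟩
    t ⟨ s ⟨ ⌊ v ⌋₁ ⟩ ⟩     ≈⟨ ⟨⟩-cong {t} (λ _ → refl) (Rev-⟨⟩ v) ⟩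
    t ⟨ X ⟩                ≈⟨ ⟨⟩-X t ⟩
    t                      ∎

infixl 7 _*₀_
infix  9 _⟨_⟩₀
infix  8 x/_ x∙_′/_

_*₀_ : 𝓕₀ → 𝓕₀ → 𝓕₀
u *₀ w = mk𝓕₀ (⌊ u ⌋₀ * ⌊ w ⌋₀)
  λ p → *ℚ-≢0 (𝓕₀.head≢0 u) (𝓕₀.head≢0 w) (trans (sym (ℚ.+-identityʳ _)) p)

_⟨_⟩₀ : 𝓕₀ → 𝓕₁ → 𝓕₀
u ⟨ v ⟩₀ = mk𝓕₀ (⌊ u ⌋₀ ⟨ ⌊ v ⌋₁ ⟩)
  λ p → 𝓕₀.head≢0 u (trans (sym (⟨⟩-head ⌊ u ⌋₀ ⌊ v ⌋₁)) p)

x/_ : 𝓕₀ → 𝓕₁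
x/ f = mk𝓕₁ (X / f) X/f₀ λ p → 1≢0 (begin
  1ℚ                                             ≡⟨ /-* X f 1 ⟨
  (X / f) 0 *ℚ f′ 1 +ℚ ((X / f) 1 *ℚ f′ 0 +ℚ 0ℚ) ≡⟨ cong₂ (λ a b → a *ℚ f′ 1 +ℚ (b *ℚ f′ 0 +ℚ 0ℚ)) X/f₀ p ⟩
  0ℚ *ℚ f′ 1 +ℚ (0ℚ *ℚ f′ 0 +ℚ 0ℚ)               ≡⟨ solve 2 (λ a b → con 0ℚ :* a :+ (con 0ℚ :* b :+ con 0ℚ) := con 0ℚ) refl (f′ 1) (f′ 0) ⟩
  0ℚ                                             ∎)
  where
  open ≡-Reasoning
  open +-*-Solver
  f′ = ⌊ f ⌋₀
  X/f₀ : (X / f) 0 ≡ 0ℚ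
  X/f₀ = ℚ.*-zeroˡ ((1/ f′ 0) ⦃ 𝓕₀.head-nonZero f ⦄)

-- x u′ / w, where numerator and denominator have each been divided by x.
x∙_′/_ : 𝓕₁ → 𝓕₁ → 𝓕₀
x∙ u ′/ w = mk𝓕₀ (tail (X * D ⌊ u ⌋₁) / 𝓕₁.series/x w)
  (/-≢0 (tail (X * D ⌊ u ⌋₁)) (𝓕₁.series/x w)
    λ p → 𝓕₁.coeff≢0 u (trans (sym (ℚ.*-identityˡ _)) (trans (sym (X-* (D ⌊ u ⌋₁) 0)) p)))

Riordan : 𝓕₀ → 𝓕₁ → ℕ → ℕ → ℚ
Riordan u v n k = [x^ + n ] (⌊ u ⌋₀ * ⌊ v ⌋₁ ^ k)

t : 𝓕₀ → 𝓕₀ → ℕ → ℕ → ℚ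
t g f n k = [x^ + n ℤ.- + k ] (⌊ g ⌋₀ * ⌊ f ⌋₀ ^ n)

{-# OPTIONS --safe #-}
-- Write R = Rev (x / f), φ = f(R), ψ = 1 / φ and Q = x R′ / R.  Then R = x φ,
-- so Q = 1 + x φ′ / φ = 1 − x ψ′ / ψ, and for n > 0
--   [xⁿ] ψⁿ Q = [xⁿ] (ψⁿ − (1/n) x (ψⁿ)′) = 0.
-- Hence a ↦ [xⁿ] a(R) ψⁿ Q and a ↦ [xⁿ] a agree: by R ψⁿ⁺¹ = x ψⁿ both drop
-- to n − 1 after splitting off the constant term of a.  The theorem is the case
-- a = xᵏ g fⁿ, where a(R) ψⁿ = Rᵏ g(R).
module Submission where

open import Algebra.Bundles using (CommutativeRing; CommutativeSemiring)
open import Data.Fin.Base using (toℕ)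
open import Data.Fin.Properties using (toℕ≤pred[n])
open import Data.Integer.Base as ℤ using (+_)
import Data.Integer.Properties as ℤ
open import Data.Nat.Base as ℕ using (ℕ; zero; suc; _∸_)
import Data.Nat.Coprimality as Coprimality
import Data.Nat.Properties as ℕ
open import Data.Rational.Base using (ℚ; 0ℚ; 1ℚ)
  renaming (_+_ to _+ℚ_; _*_ to _*ℚ_; _/_ to _/ℚ_)
import Data.Rational.Properties as ℚ
open import Data.Rational.Literals using (fromℤ)
open import Data.Rational.Solver using (module +-*-Solver)
open import Relation.Binary.PropositionalEquality
  using (_≡_; refl; sym; trans; cong; cong₂; module ≡-Reasoning)
open import Defs

open CommutativeSemiring commutativeSemiring
  using (setoid; +-cong; +-congˡ; +-congʳ; +-identityʳ; *-congˡ; *-congʳ; *-identityʳ)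
open import Algebra.Properties.CommutativeSemiring.Exp commutativeSemiring
  using (_^_; ^-congˡ; ^-distrib-*)
open import Algebra.Properties.Group ℚ.+-0-group using (identityˡ-unique)
open import Algebra.Properties.Semiring.Sum (CommutativeRing.semiring ℚ.+-*-commutativeRing)
  using (sum-cong-≗; ∑-distrib-+; *-distribˡ-sum)
open import Algebra.Solver.Ring.NaturalCoefficients.Default commutativeSemiring
  using (solve; con; _:+_; _:*_; _:=_)
open import Relation.Binary.Reasoning.Setoid setoid

-- The same expression as the factor in `D`, so `D a n` is `ι (suc n) *ℚ a (suc n)` by definition.
ι : ℕ → ℚ
ι n = + n /ℚ 1

-- For a variable `n` the gcd normalisation inside `/ℚ` is stuck. A fraction over 1 is already
-- reduced, and on the literal `fromℤ` addition unfolds.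
ι≡fromℤ : ∀ n → ι n ≡ fromℤ (+ n)
ι≡fromℤ n = ℚ.normalize-coprime (Coprimality.sym (Coprimality.1-coprimeTo n))

ι-+ : ∀ m n → ι (m ℕ.+ n) ≡ ι m +ℚ ι n
ι-+ m n = sym (trans (cong₂ _+ℚ_ (ι≡fromℤ m) (ι≡fromℤ n))
  (cong (_/ℚ 1) (cong₂ ℤ._+_ (ℤ.*-identityʳ (+ m)) (ℤ.*-identityʳ (+ n)))))

-- A positive factor cancels from an inequality; applied in both directions, this gives the
-- equality.
ι-cancel : ∀ n {p q} → ι (suc n) *ℚ p ≡ ι (suc n) *ℚ q → p ≡ q
ι-cancel n eq = ℚ.≤-antisym
  (ℚ.*-cancelˡ-≤-pos (ι (suc n)) (ℚ.≤-reflexive eq))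
  (ℚ.*-cancelˡ-≤-pos (ι (suc n)) (ℚ.≤-reflexive (sym eq)))
  where instance _ = ℚ.normalize-pos (suc n) 1

-- The derivation x d/dx.
θ : Series → Series
θ a n = ι n *ℚ a n

θ-cong : ∀ {a b} → a ≈ b → θ a ≈ θ b
θ-cong p n = cong (ι n *ℚ_) (p n)

θ-1 : θ (const 1ℚ) ≈ const 0ℚ
θ-1 zero    = refl
θ-1 (suc n) = ℚ.*-zeroʳ (ι (suc n))

-- In the Cauchy product the weight `n` of the `i`-th term splits as `i + (n ∸ i)`, one summand for
-- each factor.
θ-* : ∀ a b → θ (a * b) ≈ θ a * b + a * θ b
θ-* a b n = trans
  (*-distribˡ-sum {suc n} (ι n) (λ i → a (toℕ i) *ℚ b (n ∸ toℕ i)))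
  (trans
    (sum-cong-≗ {suc n} λ i → leibniz (toℕ i) (n ∸ toℕ i) (ℕ.m+[n∸m]≡n (toℕ≤pred[n] i)))
    (∑-distrib-+ {suc n} (λ i → θ a (toℕ i) *ℚ b (n ∸ toℕ i))
                         (λ i → a (toℕ i) *ℚ θ b (n ∸ toℕ i))))
  where
  leibniz : ∀ i j {m} → i ℕ.+ j ≡ m → ι m *ℚ (a i *ℚ b j) ≡ θ a i *ℚ b j +ℚ a i *ℚ θ b j
  leibniz i j refl = trans (cong (_*ℚ (a i *ℚ b j)) (ι-+ i j))
    (S.solve 4 (λ p q r s → (p S.:+ q) S.:* (r S.:* s) S.:= (p S.:* r) S.:* s S.:+ r S.:* (q S.:* s))
      refl (ι i) (ι j) (a i) (b j))
    where module S = +-*-Solver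

-- Brings the scalar into the shape `con 1 :+ c` that the semiring solver handles.
const-ι-suc : ∀ n → const (ι (suc n)) ≈ const 1ℚ + const (ι n)
const-ι-suc n zero    = ι-+ 1 n
const-ι-suc n (suc _) = refl

-- Here `e` stands for the logarithmic derivative `θ a / a`. With it the power rule needs neither a
-- division nor the exponent `n - 1`.
θ-^ : ∀ {a e} → θ a ≈ a * e → ∀ n → θ (a ^ n) ≈ const (ι n) * (a ^ n * e)
θ-^ {a} {e} θa zero = begin
  θ (const 1ℚ)                  ≈⟨ θ-1 ⟩
  const 0ℚ                      ≈⟨ *-zeroˡ (const 1ℚ * e) ⟨
  const 0ℚ * (const 1ℚ * e)     ∎
θ-^ {a} {e} θa (suc n) = begin
  θ (a * a ^ n)                               ≈⟨ θ-* a (a ^ n) ⟩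
  θ a * a ^ n + a * θ (a ^ n)
    ≈⟨ +-cong (*-congʳ {a ^ n} {θ a} θa) (*-congˡ {a} {θ (a ^ n)} (θ-^ θa n)) ⟩
  a * e * a ^ n + a * (c * (a ^ n * e))
    ≈⟨ solve 4 (λ a e p c → a :* e :* p :+ a :* (c :* (p :* e)) := (con 1 :+ c) :* (a :* p :* e))
         (λ _ → refl) a e (a ^ n) c ⟩
  (const 1ℚ + c) * (a * a ^ n * e)            ≈⟨ *-congʳ {a * a ^ n * e} {const (ι (suc n))} (const-ι-suc n) ⟨
  const (ι (suc n)) * (a * a ^ n * e)         ∎
  where c = const (ι n)

^-1 : ∀ n → const 1ℚ ^ n ≈ const 1ℚ
^-1 zero    _ = refl
^-1 (suc n) k = trans (*-identityˡ (const 1ℚ ^ n) k) (^-1 n k)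

-- Absorbs the integer index into the series; for `n < k` both sides vanish.
X^-* : ∀ k n a → [x^ + n ℤ.- + k ] a ≡ (X ^ k * a) n
X^-* k n a = trans (cong ([x^_] a) (ℤ.m-n≡m⊖n n k)) (shift k n)
  where
  shift : ∀ k n → [x^ n ℤ.⊖ k ] a ≡ (X ^ k * a) n
  shift zero    n       = sym (*-identityˡ a n)
  shift (suc k) zero    = sym (trans (*-assoc X (X ^ k) a 0)
    (trans (ℚ.+-identityʳ _) (ℚ.*-zeroˡ ((X ^ k * a) 0))))
  shift (suc k) (suc n) = trans (cong ([x^_] a) (ℤ.[1+m]⊖[1+n]≡m⊖n n k)) (trans (shift k n)
    (sym (trans (*-assoc X (X ^ k) a (suc n)) (X-* (X ^ k * a) n))))

⟨⟩-^ : ∀ a v → v 0 ≡ 0ℚ → ∀ n → (a ^ n) ⟨ v ⟩ ≈ a ⟨ v ⟩ ^ n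
⟨⟩-^ a v v₀ zero    = ⟨⟩-const 1ℚ v
⟨⟩-^ a v v₀ (suc n) = begin
  (a * a ^ n) ⟨ v ⟩           ≈⟨ ⟨⟩-* a (a ^ n) v v₀ ⟩
  a ⟨ v ⟩ * (a ^ n) ⟨ v ⟩     ≈⟨ *-congˡ {a ⟨ v ⟩} {(a ^ n) ⟨ v ⟩} (⟨⟩-^ a v v₀ n) ⟩
  a ⟨ v ⟩ * a ⟨ v ⟩ ^ n       ∎

-- The hypothesis on q reads q = 1 − θψ/ψ when φ = 1/ψ.
diagonal : ∀ {φ ψ q} → ψ * φ ≈ const 1ℚ → q + φ * θ ψ ≈ const 1ℚ → ∀ n → (ψ ^ n * q) n ≡ const 1ℚ n
-- At index 0 the weight in `θ` is 0, so the hypothesis reduces to `q 0 ≡ 1ℚ`.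
diagonal {φ} {ψ} {q} ψφ q+e zero    = trans
  (S.solve 3 (λ q φ ψ → S.con 1ℚ S.:* q S.:+ S.con 0ℚ S.:= q S.:+ (φ S.:* (S.con 0ℚ S.:* ψ) S.:+ S.con 0ℚ))
    refl (q 0) (φ 0) (ψ 0))
  (q+e 0)
  where module S = +-*-Solver
-- Coefficient `m` of `θ (ψ ^ m)` is `m` times that of `ψ ^ m`, and by the power rule also `m` times
-- that of `ψ ^ m * e`. As `m` is positive it cancels, and `split` leaves 0 for the coefficient of
-- `ψ ^ m * q`.
diagonal {φ} {ψ} {q} ψφ q+e (suc n) = identityˡ-unique _ ((ψ ^ m * e) m) (ι-cancel n
  (trans (cong (ι m *ℚ_) (split m)) (trans (θ-^ {ψ} {e} θψ m m) (const-* (ι m) (ψ ^ m * e) m))))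
  where
  m = suc n
  e = φ * θ ψ
  θψ : θ ψ ≈ ψ * e
  θψ = begin
    θ ψ              ≈⟨ *-identityˡ (θ ψ) ⟨
    const 1ℚ * θ ψ   ≈⟨ *-congʳ {θ ψ} {ψ * φ} ψφ ⟨
    ψ * φ * θ ψ      ≈⟨ *-assoc ψ φ (θ ψ) ⟩
    ψ * e            ∎
  split : ψ ^ m * q + ψ ^ m * e ≈ ψ ^ m
  split = begin
    ψ ^ m * q + ψ ^ m * e   ≈⟨ *-distribˡ-+ (ψ ^ m) q e ⟨
    ψ ^ m * (q + e)         ≈⟨ *-congˡ {ψ ^ m} {q + e} q+e ⟩
    ψ ^ m * const 1ℚ        ≈⟨ *-identityʳ (ψ ^ m) ⟩
    ψ ^ m                   ∎

-- A form of Lagrange inversion. The induction on `n` keeps `a` arbitrary, since each step replaces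
-- `a` by `tail a`.
substitution-coefficient : ∀ {R φ ψ q} → R ≈ X * φ → ψ * φ ≈ const 1ℚ → q + φ * θ ψ ≈ const 1ℚ →
                           ∀ n a → (a ⟨ R ⟩ * (ψ ^ n * q)) n ≡ a n
substitution-coefficient {R} {φ} {ψ} {q} R≈Xφ ψφ q+e = go
  where
  R₀ : R 0 ≡ 0ℚ
  R₀ = trans (R≈Xφ 0) (trans (ℚ.+-identityʳ _) (ℚ.*-zeroˡ (φ 0)))
  split : ∀ n a → a ⟨ R ⟩ * (ψ ^ n * q) ≈ a 0 ∙ (ψ ^ n * q) + R * tail a ⟨ R ⟩ * (ψ ^ n * q)
  split n a = begin
    a ⟨ R ⟩ * P                                    ≈⟨ *-congʳ {P} {a ⟨ R ⟩} (⟨⟩-horner a R R₀) ⟩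
    (const (a 0) + R * tail a ⟨ R ⟩) * P           ≈⟨ *-distribʳ-+ P (const (a 0)) (R * tail a ⟨ R ⟩) ⟩
    const (a 0) * P + R * tail a ⟨ R ⟩ * P         ≈⟨ +-congʳ {R * tail a ⟨ R ⟩ * P} {const (a 0) * P} (const-* (a 0) P) ⟩
    a 0 ∙ P + R * tail a ⟨ R ⟩ * P                 ∎
    where P = ψ ^ n * q
  lower : ∀ n b → R * b * (ψ ^ suc n * q) ≈ X * (b * (ψ ^ n * q))
  lower n b = begin
    R * b * (ψ * ψ ^ n * q)               ≈⟨ *-congʳ {ψ ^ suc n * q} {R * b} (*-congʳ {b} {R} R≈Xφ) ⟩
    X * φ * b * (ψ * ψ ^ n * q)
      ≈⟨ solve 6 (λ X φ b ψ p q → X :* φ :* b :* (ψ :* p :* q) := ψ :* φ :* (X :* (b :* (p :* q))))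
           (λ _ → refl) X φ b ψ (ψ ^ n) q ⟩
    ψ * φ * (X * (b * (ψ ^ n * q)))       ≈⟨ *-congʳ {X * (b * (ψ ^ n * q))} {ψ * φ} ψφ ⟩
    const 1ℚ * (X * (b * (ψ ^ n * q)))    ≈⟨ *-identityˡ _ ⟩
    X * (b * (ψ ^ n * q))                 ∎
  go : ∀ n a → (a ⟨ R ⟩ * (ψ ^ n * q)) n ≡ a n
  go zero    a = ≡.begin
    (a ⟨ R ⟩) 0 *ℚ (const 1ℚ * q) 0 +ℚ 0ℚ   ≡.≡⟨ ℚ.+-identityʳ _ ⟩
    (a ⟨ R ⟩) 0 *ℚ (const 1ℚ * q) 0         ≡.≡⟨ cong₂ _*ℚ_ (⟨⟩-head a R) (diagonal {φ} {ψ} {q} ψφ q+e 0) ⟩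
    a 0 *ℚ 1ℚ                               ≡.≡⟨ ℚ.*-identityʳ (a 0) ⟩
    a 0                                     ≡.∎
    where module ≡ = ≡-Reasoning
  go (suc n) a = ≡.begin
    (a ⟨ R ⟩ * (ψ ^ suc n * q)) (suc n)
      ≡.≡⟨ split (suc n) a (suc n) ⟩
    a 0 *ℚ (ψ ^ suc n * q) (suc n) +ℚ (R * tail a ⟨ R ⟩ * (ψ ^ suc n * q)) (suc n)
      -- The constant term of `a` contributes nothing at a positive index; in the rest one `ψ`
      -- cancels the `φ` in `R`, and the remaining `X` lowers the index.
      ≡.≡⟨ cong₂ _+ℚ_ (trans (cong (a 0 *ℚ_) (diagonal {φ} {ψ} {q} ψφ q+e (suc n))) (ℚ.*-zeroʳ (a 0)))
                      (lower n (tail a ⟨ R ⟩) (suc n)) ⟩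
    0ℚ +ℚ (X * (tail a ⟨ R ⟩ * (ψ ^ n * q))) (suc n)
      ≡.≡⟨ ℚ.+-identityˡ _ ⟩
    (X * (tail a ⟨ R ⟩ * (ψ ^ n * q))) (suc n)
      ≡.≡⟨ X-* (tail a ⟨ R ⟩ * (ψ ^ n * q)) n ⟩
    (tail a ⟨ R ⟩ * (ψ ^ n * q)) n
      ≡.≡⟨ go n (tail a) ⟩
    a (suc n) ≡.∎
    where module ≡ = ≡-Reasoning

-- Substitute the reversion into `(x / f) f = x`: the first factor becomes `x`.
Rev-x/ : ∀ f → ⌊ Rev (x/ f) ⌋₁ ≈ X * ⌊ f ⟨ Rev (x/ f) ⟩₀ ⌋₀
Rev-x/ f = begin
  R                                   ≈⟨ X-⟨⟩ R refl ⟨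
  X ⟨ R ⟩                             ≈⟨ ⟨⟩-cong {v = R} (/-* X f) (λ _ → refl) ⟨
  (⌊ x/ f ⌋₁ * ⌊ f ⌋₀) ⟨ R ⟩          ≈⟨ ⟨⟩-* ⌊ x/ f ⌋₁ ⌊ f ⌋₀ R refl ⟩
  ⌊ x/ f ⌋₁ ⟨ R ⟩ * ⌊ f ⌋₀ ⟨ R ⟩      ≈⟨ *-congʳ {⌊ f ⌋₀ ⟨ R ⟩} {⌊ x/ f ⌋₁ ⟨ R ⟩} (⟨⟩-Rev (x/ f)) ⟩
  X * ⌊ f ⌋₀ ⟨ R ⟩                    ∎
  where R = ⌊ Rev (x/ f) ⌋₁

-- Since `w / x = φ`, the left side is `w′`, which is the derivative of `x φ`.
x∙′/-product : ∀ w {φ} → ⌊ w ⌋₁ ≈ X * φ → ⌊ x∙ w ′/ w ⌋₀ * φ ≈ φ + θ φ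
x∙′/-product w {φ} w≈Xφ = begin
  q * φ                   ≈⟨ *-congˡ {q} {tail W} tail-w ⟨
  q * tail W              ≈⟨ /-* (tail (X * D W)) (𝓕₁.series/x w) ⟩
  tail (X * D W)          ≈⟨ X-* (D W) ⟩
  D W                     ≈⟨ (λ n → cong (ι (suc n) *ℚ_) (tail-w n)) ⟩
  (λ n → ι (suc n) *ℚ φ n)
    ≈⟨ (λ n → trans (cong (_*ℚ φ n) (ι-+ 1 n)) (trans (ℚ.*-distribʳ-+ (φ n) 1ℚ (ι n)) (cong (_+ℚ θ φ n) (ℚ.*-identityˡ (φ n))))) ⟩
  φ + θ φ                 ∎
  where
  W = ⌊ w ⌋₁
  q = ⌊ x∙ w ′/ w ⌋₀
  tail-w : tail W ≈ φ
  tail-w n = trans (w≈Xφ (suc n)) (X-* φ n)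

-- Multiplying the second hypothesis by `ψ` gives `q = 1 + ψ θφ`, and applying `θ` to `ψ φ = 1`
-- gives `ψ θφ + φ θψ = 0`. The additive form avoids subtraction of series.
log-derivative : ∀ {φ ψ q} → ψ * φ ≈ const 1ℚ → q * φ ≈ φ + θ φ → q + φ * θ ψ ≈ const 1ℚ
log-derivative {φ} {ψ} {q} ψφ qφ = begin
  q + φ * θ ψ                       ≈⟨ +-congʳ {φ * θ ψ} {q} q≈ ⟩
  const 1ℚ + ψ * θ φ + φ * θ ψ
    ≈⟨ solve 4 (λ φ ψ φ′ ψ′ → con 1 :+ ψ :* φ′ :+ φ :* ψ′ := con 1 :+ (ψ′ :* φ :+ ψ :* φ′))
         (λ _ → refl) φ ψ (θ φ) (θ ψ) ⟩
  const 1ℚ + (θ ψ * φ + ψ * θ φ)    ≈⟨ +-congˡ {const 1ℚ} {θ (ψ * φ)} (θ-* ψ φ) ⟨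
  const 1ℚ + θ (ψ * φ)              ≈⟨ +-congˡ {const 1ℚ} {θ (ψ * φ)} (θ-cong {ψ * φ} ψφ) ⟩
  const 1ℚ + θ (const 1ℚ)           ≈⟨ +-congˡ {const 1ℚ} {θ (const 1ℚ)} θ-1 ⟩
  const 1ℚ + const 0ℚ               ≈⟨ +-identityʳ (const 1ℚ) ⟩
  const 1ℚ                          ∎
  where
  q≈ : q ≈ const 1ℚ + ψ * θ φ
  q≈ = begin
    q                       ≈⟨ *-identityʳ q ⟨
    q * const 1ℚ            ≈⟨ *-congˡ {q} {ψ * φ} ψφ ⟨
    q * (ψ * φ)             ≈⟨ solve 3 (λ q ψ φ → q :* (ψ :* φ) := ψ :* (q :* φ)) (λ _ → refl) q ψ φ ⟩
    ψ * (q * φ)             ≈⟨ *-congˡ {ψ} {q * φ} qφ ⟩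
    ψ * (φ + θ φ)           ≈⟨ *-distribˡ-+ ψ φ (θ φ) ⟩
    ψ * φ + ψ * θ φ         ≈⟨ +-congʳ {ψ * θ φ} {ψ * φ} ψφ ⟩
    const 1ℚ + ψ * θ φ      ∎

proposition2 : (g f : 𝓕₀) (n k : ℕ) →
    t g f n k ≡ Riordan (g ⟨ Rev (x/ f) ⟩₀ *₀ x∙ Rev (x/ f) ′/ Rev (x/ f)) (Rev (x/ f)) n k
proposition2 g f n k = trans (X^-* k n (G * F ^ n)) (trans
  (sym (substitution-coefficient {R} {φ} {ψ} {q} (Rev-x/ f) ψφ
    (log-derivative {φ} {ψ} {q} ψφ (x∙′/-product (Rev (x/ f)) {φ} (Rev-x/ f))) n (X ^ k * (G * F ^ n))))
  (cancel-φ n))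
  where
  G = ⌊ g ⌋₀
  F = ⌊ f ⌋₀
  R = ⌊ Rev (x/ f) ⌋₁
  φ = F ⟨ R ⟩
  ψ = const 1ℚ / f ⟨ Rev (x/ f) ⟩₀
  q = ⌊ x∙ Rev (x/ f) ′/ Rev (x/ f) ⌋₀
  ψφ : ψ * φ ≈ const 1ℚ
  ψφ = /-* (const 1ℚ) (f ⟨ Rev (x/ f) ⟩₀)
  ψφ^ : ψ ^ n * φ ^ n ≈ const 1ℚ
  ψφ^ = begin
    ψ ^ n * φ ^ n     ≈⟨ ^-distrib-* ψ φ n ⟨
    (ψ * φ) ^ n       ≈⟨ ^-congˡ n {ψ * φ} ψφ ⟩
    const 1ℚ ^ n      ≈⟨ ^-1 n ⟩
    const 1ℚ          ∎
  composite : (X ^ k * (G * F ^ n)) ⟨ R ⟩ ≈ R ^ k * (G ⟨ R ⟩ * φ ^ n)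
  composite = begin
    (X ^ k * (G * F ^ n)) ⟨ R ⟩            ≈⟨ ⟨⟩-* (X ^ k) (G * F ^ n) R refl ⟩
    (X ^ k) ⟨ R ⟩ * (G * F ^ n) ⟨ R ⟩
      ≈⟨ CommutativeSemiring.*-cong commutativeSemiring {(X ^ k) ⟨ R ⟩} {R ^ k} {(G * F ^ n) ⟨ R ⟩} {G ⟨ R ⟩ * φ ^ n}
           (λ i → trans (⟨⟩-^ X R refl k i) (^-congˡ k {X ⟨ R ⟩} (X-⟨⟩ R refl) i))
           (λ i → trans (⟨⟩-* G (F ^ n) R refl i) (*-congˡ {G ⟨ R ⟩} {(F ^ n) ⟨ R ⟩} (⟨⟩-^ F R refl n) i)) ⟩
    R ^ k * (G ⟨ R ⟩ * φ ^ n)              ∎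
  -- The factor `ψ ^ n` removes the `φ ^ n` coming from `F ^ n`. The resulting series no longer
  -- depends on `n`, as the column of a Riordan array requires.
  cancel-φ : (X ^ k * (G * F ^ n)) ⟨ R ⟩ * (ψ ^ n * q) ≈ G ⟨ R ⟩ * q * R ^ k
  cancel-φ = begin
    (X ^ k * (G * F ^ n)) ⟨ R ⟩ * (ψ ^ n * q)
      ≈⟨ *-congʳ {ψ ^ n * q} {(X ^ k * (G * F ^ n)) ⟨ R ⟩} composite ⟩
    R ^ k * (G ⟨ R ⟩ * φ ^ n) * (ψ ^ n * q)
      ≈⟨ solve 5 (λ r g p s q → r :* (g :* p) :* (s :* q) := s :* p :* (g :* q :* r))
           (λ _ → refl) (R ^ k) (G ⟨ R ⟩) (φ ^ n) (ψ ^ n) q ⟩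
    ψ ^ n * φ ^ n * (G ⟨ R ⟩ * q * R ^ k)
      ≈⟨ *-congʳ {G ⟨ R ⟩ * q * R ^ k} {ψ ^ n * φ ^ n} ψφ^ ⟩
    const 1ℚ * (G ⟨ R ⟩ * q * R ^ k)
      ≈⟨ *-identityˡ _ ⟩
    G ⟨ R ⟩ * q * R ^ k ∎
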